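{- For every natural number $n\geq 1$, $\tau(B_n) > B_{\lfloor \tau(n)/3\rfloor}$, where $\lfloor\cdot\rfloor$ denotes the floor function.
   Context: The balancing numbers $(B_n)_{n\geq 0}$ are defined by $B_0=0$, $B_1=1$, $B_{n+1}=6B_n-B_{n-1}$ for $n\geq 1$. For a positive integer $m$, $\tau(m)$ denotes the number of positive divisors of $m$. -}

module Defs where

open import Data.List using (List; length; filter; map; upTo)
open import Data.Nat using (ℕ; zero; suc; _+_; _*_; _∸_; _≤_; z≤n)
open import Data.Nat.Divisibility using (_∣?_)
open import Data.Nat.Properties using (≤-trans; m≤m+n; m∸n+n≡m; +-∸-assoc; m≤n*m)
open import Relation.Binary.PropositionalEquality using (_≡_; sym; subst)

-- The subtraction is never truncated: see B-recurrence.
B : ℕ → ℕ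
B zero          = 0
B (suc zero)    = 1
B (suc (suc n)) = 6 * B (suc n) ∸ B n

B-mono : ∀ n → B n ≤ B (suc n)
B-mono zero    = z≤n
B-mono (suc n) =
  subst (B (suc n) ≤_) (sym (+-∸-assoc (B (suc n)) Bn≤5B)) (m≤m+n (B (suc n)) _)
  where
  Bn≤5B : B n ≤ 5 * B (suc n)
  Bn≤5B = ≤-trans (B-mono n) (m≤n*m (B (suc n)) 5)

B-recurrence : ∀ n → B (suc (suc n)) + B n ≡ 6 * B (suc n)
B-recurrence n = m∸n+n≡m (≤-trans (B-mono n) (m≤n*m (B (suc n)) 6))

divisors : ℕ → List ℕ
divisors m = filter (_∣? m) (map suc (upTo m))

-- For m ≥ 1, the number of positive divisors of m (junk value τ 0 = 0).
τ : ℕ → ℕ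
τ m = length (divisors m)

{-# OPTIONS --safe #-}

-- For every d ≥ 2 the number B(d) has a primitive prime divisor: a prime dividing B(d) but no B(e)
-- with e a proper divisor of d.  Since gcd(B(m), B(n)) = B(gcd(m, n)), the primitive primes of the
-- divisors d > 1 of n are distinct divisors of B(n), so τ(B(n)) ≥ 2^(τ(n) − 1), while 2B(k) < 8^k.
--
-- For the primitive divisor, let L be the lcm of the B(d/q) over the primes q ∣ d.  If a prime p
-- divides both B(d/q) and B(d)/B(d/q), then p = q and p² ∤ B(d)/B(d/q), because B(qm)/B(m) ≡ q
-- modulo 32B(m)² for odd q and (B(2m)/B(m))² = 4 + 32B(m)².  Hence B(d)/L divides the product of
-- the primes q ∣ d unless there is a primitive prime.  Inclusion–exclusion over these primes gives
-- B(d)/L ≥ (5/2)^∏(q − 1), which exceeds ∏ q.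
module Submission where

open import Data.Empty using (⊥)
import Data.Integer.Divisibility.Signed as ℤ∣
import Data.Integer.Properties as ℤₚ
import Data.Integer.Tactic.RingSolver as ℤSolver
open import Data.List using (List; []; _∷_; _++_; map; filter; upTo; applyUpTo; length)
open import Data.List.Membership.Propositional using (_∈_; _∉_)
open import Data.List.Membership.Propositional.Properties using (∈-filter⁺; ∈-filter⁻; ∈-map⁺; ∈-map⁻; ∈-upTo⁺)
open import Data.List.Properties using (length-map; length-++; filter-accept)
open import Data.List.Relation.Unary.All as All using (All; []; _∷_)
import Data.List.Relation.Unary.All.Properties as Allₚ
open import Data.List.Relation.Unary.AllPairs using (AllPairs; []; _∷_)
open import Data.List.Relation.Unary.Any using (here; there; _─_)
open import Data.List.Relation.Unary.Unique.Propositional using (Unique)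
import Data.List.Relation.Unary.Unique.Propositional.Properties as Uniqueₚ
open import Data.Nat as ℕ using (ℕ; zero; suc; NonZero; _≥_; _>_)
open import Data.Nat.Coprimality using (Coprime; coprime⇒gcd≡1)
open import Data.Nat.DivMod using (_/_; m/n*n≤m)
open import Data.Nat.Divisibility as ℕ∣ using (_∣_)
open import Data.Nat.GCD
open import Data.Nat.LCM using (lcm; m∣lcm[m,n]; n∣lcm[m,n]; lcm-least; gcd*lcm)
open import Data.Nat.ListAction using (product)
open import Data.Nat.Primality
open import Data.Nat.Primality.Factorisation using (factorise; factorisationHasAllPrimeFactors)
import Data.Nat.Properties as ℕₚ
open import Data.Nat.Tactic.RingSolver using (solve-∀)
open import Data.Product using (∃; ∃₂; _×_; _,_; proj₁; proj₂)
open import Data.Sum using (_⊎_; inj₁; inj₂)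
open import Relation.Binary.PropositionalEquality using (_≡_; _≢_; refl; sym; trans; cong; cong₂; subst; subst₂; module ≡-Reasoning)
open import Relation.Nullary using (¬_; yes; no; contradiction)
open import Relation.Nullary.Decidable using (_×-dec_; toWitnessFalse)
open import Defs using (B; B-mono; B-recurrence; τ; divisors)

-- Positivity of B, parity and primes

B-nonZero : ∀ n .{{_ : NonZero n}} → NonZero (B n)
B-nonZero (suc n) = ℕ.>-nonZero (go n)
  where
  go : ∀ n → 0 ℕ.< B (suc n)
  go zero    = ℕ.s≤s ℕ.z≤n
  go (suc n) = ℕₚ.≤-trans (go n) (B-mono (suc n))

2∣⊎odd : ∀ n → 2 ∣ n ⊎ ∃ λ j → n ≡ suc (j ℕ.* 2)
2∣⊎odd zero    = inj₁ (2 ℕ∣.∣0)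
2∣⊎odd (suc n) with 2∣⊎odd n
... | inj₁ (ℕ∣.divides j eq) = inj₂ (j , cong suc eq)
... | inj₂ (j , eq)          = inj₁ (ℕ∣.divides (suc j) (cong suc eq))

prime-∣-prime : ∀ {p q} → Prime p → Prime q → p ∣ q → p ≡ q
prime-∣-prime pp pq p∣q with prime⇒irreducible pq p∣q
... | inj₁ refl = contradiction pp ¬prime[1]
... | inj₂ eq   = eq

p²∤p : ∀ {p} → Prime p → ¬ p ℕ.* p ∣ p
p²∤p {p} pp p²∣p = contradiction (subst Prime p≡1 pp) ¬prime[1]
  where
  instance _ = prime⇒nonZero pp
  p≡1 : p ≡ 1
  p≡1 = ℕ∣.∣1⇒≡1 (ℕ∣.*-cancelˡ-∣ p (subst (p ℕ.* p ∣_) (sym (ℕₚ.*-identityʳ p)) p²∣p))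

-- Integer identities, common divisors of the B(n), and the quotients B(qm)/B(m)

module Identities where

  open import Data.Integer using (ℤ; +_; _+_; _*_; _-_)
  open ℤ∣ using (∣ᵤ⇒∣; ∣⇒∣ᵤ)

  b : ℕ → ℤ
  b n = + B n

  b-rec : ∀ n → b (2 ℕ.+ n) ≡ + 6 * b (suc n) - b n
  b-rec n = begin
    b (2 ℕ.+ n)                    ≡⟨ x≡x+y-y (b (2 ℕ.+ n)) (b n) ⟩
    b (2 ℕ.+ n) + b n - b n        ≡⟨ cong (_- b n) (sym (ℤₚ.pos-+ (B (2 ℕ.+ n)) (B n))) ⟩
    + (B (2 ℕ.+ n) ℕ.+ B n) - b n  ≡⟨ cong (λ z → + z - b n) (B-recurrence n) ⟩
    + (6 ℕ.* B (suc n)) - b n      ≡⟨ cong (_- b n) (ℤₚ.pos-* 6 (B (suc n))) ⟩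
    + 6 * b (suc n) - b n          ∎
    where
    open ≡-Reasoning
    x≡x+y-y : ∀ x y → x ≡ x + y - y
    x≡x+y-y = ℤSolver.solve-∀

  -- The quadratic form x² + y² - 6xy is invariant under the step (x, y) ↦ (y, 6y - x) of the
  -- recurrence.
  b-cassini : ∀ n → b (suc n) * b (suc n) + b n * b n - + 6 * b n * b (suc n) ≡ + 1
  b-cassini zero    = refl
  b-cassini (suc n) = trans (cong (λ z → z * z + b (suc n) * b (suc n) - + 6 * b (suc n) * z) (b-rec n))
                            (trans (identity (b n) (b (suc n))) (b-cassini n))
    where
    identity : ∀ x y → (+ 6 * y - x) * (+ 6 * y - x) + y * y - + 6 * y * (+ 6 * y - x)
                     ≡ y * y + x * x - + 6 * x * y
    identity = ℤSolver.solve-∀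

  -- Proved together by induction on n. The second formula avoids the index m - 1 by writing B(m -
  -- 1) as 6B(m) - B(m + 1).
  b-add-suc : ∀ n m → b (suc (n ℕ.+ m)) ≡ b (suc n) * b (suc m) - b n * b m
  b-add : ∀ n m → b (n ℕ.+ m) ≡ b (suc n) * b m + b n * b (suc m) - + 6 * b n * b m

  b-add zero m = identity (b m) (b (suc m))
    where
    identity : ∀ x y → x ≡ + 1 * x + + 0 * y - + 6 * + 0 * x
    identity = ℤSolver.solve-∀
  b-add (suc n) m = trans (b-add-suc n m)
    (trans (identity (b n) (b (suc n)) (b m) (b (suc m)))
           (cong (λ z → z * b m + b (suc n) * b (suc m) - + 6 * b (suc n) * b m) (sym (b-rec n))))
    where
    identity : ∀ u v x y → v * y - u * x ≡ (+ 6 * v - u) * x + v * y - + 6 * v * x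
    identity = ℤSolver.solve-∀

  b-add-suc zero    m = identity (b m) (b (suc m))
    where
    identity : ∀ x y → y ≡ + 1 * y - + 0 * x
    identity = ℤSolver.solve-∀
  b-add-suc (suc n) m = begin
    b (2 ℕ.+ (n ℕ.+ m))                      ≡⟨ b-rec (n ℕ.+ m) ⟩
    + 6 * b (suc (n ℕ.+ m)) - b (n ℕ.+ m)    ≡⟨ cong₂ (λ y z → + 6 * y - z) (b-add-suc n m) (b-add n m) ⟩
    _                                        ≡⟨ identity (b n) (b (suc n)) (b m) (b (suc m)) ⟩
    _                                        ≡⟨ cong (λ z → z * b (suc m) - b (suc n) * b m) (sym (b-rec n)) ⟩
    b (2 ℕ.+ n) * b (suc m) - b (suc n) * b m ∎
    where
    open ≡-Reasoning
    identity : ∀ u v x y → + 6 * (v * y - u * x) - (v * x + u * y - + 6 * u * x)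
                         ≡ (+ 6 * v - u) * y - v * x
    identity = ℤSolver.solve-∀

  B-add-suc : ∀ n m → B (suc (n ℕ.+ m)) ℕ.+ B n ℕ.* B m ≡ B (suc n) ℕ.* B (suc m)
  B-add-suc n m = ℤₚ.+-injective (begin
    + (B (suc (n ℕ.+ m)) ℕ.+ B n ℕ.* B m)               ≡⟨ ℤₚ.pos-+ (B (suc (n ℕ.+ m))) (B n ℕ.* B m) ⟩
    b (suc (n ℕ.+ m)) + + (B n ℕ.* B m)                 ≡⟨ cong₂ _+_ (b-add-suc n m) (ℤₚ.pos-* (B n) (B m)) ⟩
    b (suc n) * b (suc m) - b n * b m + b n * b m       ≡⟨ x-y+y≡x (b (suc n) * b (suc m)) (b n * b m) ⟩
    b (suc n) * b (suc m)                               ≡⟨ sym (ℤₚ.pos-* (B (suc n)) (B (suc m))) ⟩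
    + (B (suc n) ℕ.* B (suc m))                         ∎)
    where
    open ≡-Reasoning
    x-y+y≡x : ∀ x y → x - y + y ≡ x
    x-y+y≡x = ℤSolver.solve-∀

  ∣B-+ : ∀ {k} n m → k ∣ B n → k ∣ B m → k ∣ B (n ℕ.+ m)
  ∣B-+ {k} n m k∣n k∣m = ∣⇒∣ᵤ (subst (+ k ℤ∣.∣_)
    (sym (trans (b-add n m) (identity (b n) (b (suc n)) (b m) (b (suc m)))))
    (ℤ∣.∣m∣n⇒∣m+n (ℤ∣.∣n⇒∣m*n (b (suc n)) (∣ᵤ⇒∣ k∣m)) (ℤ∣.∣n⇒∣m*n (b (suc m) - + 6 * b m) (∣ᵤ⇒∣ k∣n))))
    where
    identity : ∀ u v x y → v * x + u * y - + 6 * u * x ≡ v * x + (y - + 6 * x) * u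
    identity = ℤSolver.solve-∀

  -- Modulo k the addition formula reads B(n + m) ≡ B(n)B(m + 1), and B(m + 1)² ≡ 1 by `b-cassini`,
  -- so multiplying by B(m + 1) recovers B(n).
  ∣B-cancel : ∀ {k} n m → k ∣ B (n ℕ.+ m) → k ∣ B m → k ∣ B n
  ∣B-cancel {k} n m k∣n+m k∣m = ∣⇒∣ᵤ (subst (+ k ℤ∣.∣_) eq
    (ℤ∣.∣m∣n⇒∣m+n (ℤ∣.∣n⇒∣m*n (b (suc m)) (∣ᵤ⇒∣ k∣n+m))
                  (ℤ∣.∣n⇒∣m*n (b n * b m - b (suc n) * b (suc m)) (∣ᵤ⇒∣ k∣m))))
    where
    open ≡-Reasoning
    identity : ∀ u v x y → y * (v * x + u * y - + 6 * u * x) + (u * x - v * y) * x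
                         ≡ u * (y * y + x * x - + 6 * x * y)
    identity = ℤSolver.solve-∀
    eq : b (suc m) * b (n ℕ.+ m) + (b n * b m - b (suc n) * b (suc m)) * b m ≡ b n
    eq = begin
      _ ≡⟨ cong (λ z → b (suc m) * z + (b n * b m - b (suc n) * b (suc m)) * b m) (b-add n m) ⟩
      _ ≡⟨ identity (b n) (b (suc n)) (b m) (b (suc m)) ⟩
      _ ≡⟨ cong (b n *_) (b-cassini m) ⟩
      b n * + 1 ≡⟨ ℤₚ.*-identityʳ (b n) ⟩
      b n ∎

  ∣B-* : ∀ {k} x m → k ∣ B m → k ∣ B (x ℕ.* m)
  ∣B-* zero    m k∣m = _ ℕ∣.∣0
  ∣B-* (suc x) m k∣m = ∣B-+ m (x ℕ.* m) k∣m (∣B-* x m k∣m)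

  B-mono-∣ : ∀ {m n} → m ∣ n → B m ∣ B n
  B-mono-∣ {m} (ℕ∣.divides x refl) = ∣B-* x m ℕ∣.∣-refl

  -- The indices n with k ∣ B(n) are closed under multiples and, by `∣B-cancel`, under subtraction,
  -- so Bézout's identity applies.
  ∣B-gcd : ∀ {k} m n → k ∣ B m → k ∣ B n → k ∣ B (gcd m n)
  ∣B-gcd {k} m n k∣m k∣n with Bézout.identity (gcd-GCD m n)
  ... | Bézout.+- x y eq = ∣B-cancel (gcd m n) (y ℕ.* n) (subst (λ z → k ∣ B z) (sym eq) (∣B-* x m k∣m)) (∣B-* y n k∣n)
  ... | Bézout.-+ x y eq = ∣B-cancel (gcd m n) (x ℕ.* m) (subst (λ z → k ∣ B z) (sym eq) (∣B-* y n k∣n)) (∣B-* x m k∣m)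

  -- t m = αᵐ + βᵐ for the roots α, β of X² − 6X + 1
  t : ℕ → ℤ
  t m = + 2 * b (suc m) - + 6 * b m

  -- This is (αᵐ - βᵐ)², since 32 = 6² - 4 is the discriminant of X² - 6X + 1.
  Δ : ℕ → ℤ
  Δ m = + 32 * (b m * b m)

  t² : ∀ m → t m * t m ≡ + 4 + Δ m
  t² m = trans (identity (b m) (b (suc m))) (cong (λ z → + 4 * z + Δ m) (b-cassini m))
    where
    identity : ∀ x y → (+ 2 * y - + 6 * x) * (+ 2 * y - + 6 * x)
                     ≡ + 4 * (y * y + x * x - + 6 * x * y) + + 32 * (x * x)
    identity = ℤSolver.solve-∀

  -- Since αᵐβᵐ = 1, the values of B along a progression of difference m obey the original
  -- recurrence with `t m` in place of 6.
  b-step : ∀ n m → b (m ℕ.+ (m ℕ.+ n)) ≡ t m * b (m ℕ.+ n) - b n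
  b-step n m = begin
    b (m ℕ.+ (m ℕ.+ n))  ≡⟨ b-add m (m ℕ.+ n) ⟩
    _ ≡⟨ cong₂ (λ y z → b (suc m) * y + b m * z - + 6 * b m * y) (b-add m n) b-suc ⟩
    _ ≡⟨ identity (b n) (b (suc n)) (b m) (b (suc m)) ⟩
    _ ≡⟨ cong₂ (λ y z → t m * y - b n * z) (sym (b-add m n)) (b-cassini m) ⟩
    t m * b (m ℕ.+ n) - b n * + 1 ≡⟨ cong (t m * b (m ℕ.+ n) -_) (ℤₚ.*-identityʳ (b n)) ⟩
    t m * b (m ℕ.+ n) - b n ∎
    where
    open ≡-Reasoning
    b-suc : b (suc (m ℕ.+ n)) ≡ b (suc m) * b (suc n) + b m * (+ 6 * b (suc n) - b n) - + 6 * b m * b (suc n)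
    b-suc = begin
      b (suc (m ℕ.+ n)) ≡⟨ cong b (sym (ℕₚ.+-suc m n)) ⟩
      b (m ℕ.+ suc n)   ≡⟨ b-add m (suc n) ⟩
      _                 ≡⟨ cong (λ z → b (suc m) * b (suc n) + b m * z - + 6 * b m * b (suc n)) (b-rec n) ⟩
      _                 ∎
    identity : ∀ u v x y →
      y * (y * u + x * v - + 6 * x * u) + x * (y * v + x * (+ 6 * v - u) - + 6 * x * v) - + 6 * x * (y * u + x * v - + 6 * x * u)
      ≡ (+ 2 * y - + 6 * x) * (y * u + x * v - + 6 * x * u) - u * (y * y + x * x - + 6 * x * y)
    identity = ℤSolver.solve-∀

  b-double : ∀ m → b (2 ℕ.* m) ≡ b m * t m
  b-double m = trans (cong (λ z → b (m ℕ.+ z)) (ℕₚ.*-identityˡ m)) (trans (b-add m m) (identity (b m) (b (suc m))))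
    where
    identity : ∀ x y → y * x + x * y - + 6 * x * x ≡ x * (+ 2 * y - + 6 * x)
    identity = ℤSolver.solve-∀

  -- As polynomials in t = t m, the quotients B(km)/B(m) are even for odd k and odd for even k;
  -- since they take the value k at t = 2, reducing modulo t² − 4 = Δ m leaves k for odd k and
  -- t · k/2 for even k.
  b-multiples : ∀ m j → ∃₂ λ x y →
    b (j ℕ.* 2 ℕ.* m) ≡ b m * (t m * + j + Δ m * y) ×
    b (suc (j ℕ.* 2) ℕ.* m) ≡ b m * (+ suc (j ℕ.* 2) + Δ m * x)
  b-multiples m zero    = + 0 , + 0 , eq₀ (b m) (t m) (Δ m) , trans (cong b (ℕₚ.+-identityʳ m)) (eq₁ (b m) (Δ m))
    where
    eq₀ : ∀ u s D → + 0 ≡ u * (s * + 0 + D * + 0)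
    eq₀ = ℤSolver.solve-∀
    eq₁ : ∀ u D → u ≡ u * (+ 1 + D * + 0)
    eq₁ = ℤSolver.solve-∀
  b-multiples m (suc j) with b-multiples m j
  ... | x , y , even , odd = x′ , y′ , even′ , odd′
    where
    open ≡-Reasoning
    k : ℕ
    k = j ℕ.* 2
    -- The coefficients of `Δ m` after one and two uses of `b-step`; the summand `+ suc j` appears
    -- when t² is replaced by 4 + `Δ m`.
    y′ x′ : ℤ
    y′ = t m * x - y
    x′ = + suc j + t m * y′ - x
    +k≡ : + k ≡ + j * + 2
    +k≡ = ℤₚ.pos-* j 2
    1+k≡ : + suc k ≡ + 1 + + j * + 2
    1+k≡ = trans (ℤₚ.pos-+ 1 k) (cong (λ z → + 1 + z) +k≡)
    3+k≡ : + (3 ℕ.+ k) ≡ + 3 + + j * + 2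
    3+k≡ = trans (ℤₚ.pos-+ 3 k) (cong (λ z → + 3 + z) +k≡)
    identity₀ : ∀ u s D j x y → s * (u * (+ 1 + j * + 2 + D * x)) - u * (s * j + D * y)
                            ≡ u * (s * (+ 1 + j) + D * (s * x - y))
    identity₀ = ℤSolver.solve-∀
    identity₁ : ∀ u s D j x y → s * (u * (s * (+ 1 + j) + D * y)) - u * (+ 1 + j * + 2 + D * x)
                            ≡ u * ((s * s) * (+ 1 + j) - + 1 - j * + 2 + D * (s * y - x))
    identity₁ = ℤSolver.solve-∀
    identity₂ : ∀ u s D j x y → u * ((+ 4 + D) * (+ 1 + j) - + 1 - j * + 2 + D * (s * y - x))
                            ≡ u * (+ 3 + j * + 2 + D * (+ 1 + j + s * y - x))
    identity₂ = ℤSolver.solve-∀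
    even′ : b (suc j ℕ.* 2 ℕ.* m) ≡ b m * (t m * + suc j + Δ m * y′)
    even′ = begin
      b (m ℕ.+ (m ℕ.+ k ℕ.* m)) ≡⟨ b-step (k ℕ.* m) m ⟩
      _ ≡⟨ cong₂ (λ p q → t m * p - q) (trans odd (cong (λ z → b m * (z + Δ m * x)) 1+k≡)) even ⟩
      _ ≡⟨ identity₀ (b m) (t m) (Δ m) (+ j) x y ⟩
      b m * (t m * + suc j + Δ m * y′) ∎
    odd′ : b (suc (suc j ℕ.* 2) ℕ.* m) ≡ b m * (+ suc (suc j ℕ.* 2) + Δ m * x′)
    odd′ = begin
      b (m ℕ.+ (m ℕ.+ (m ℕ.+ k ℕ.* m))) ≡⟨ b-step (m ℕ.+ k ℕ.* m) m ⟩
      _ ≡⟨ cong₂ (λ p q → t m * p - q) even′ (trans odd (cong (λ z → b m * (z + Δ m * x)) 1+k≡)) ⟩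
      _ ≡⟨ identity₁ (b m) (t m) (Δ m) (+ j) x y′ ⟩
      _ ≡⟨ cong (λ z → b m * (z * (+ 1 + + j) - + 1 - + j * + 2 + Δ m * (t m * y′ - x))) (t² m) ⟩
      _ ≡⟨ identity₂ (b m) (t m) (Δ m) (+ j) x y′ ⟩
      _ ≡⟨ cong (λ z → b m * (z + Δ m * x′)) (sym 3+k≡) ⟩
      b m * (+ suc (suc j ℕ.* 2) + Δ m * x′) ∎

  ∣Δ : ∀ {p m} → p ∣ B m → + (p ℕ.* p) ℤ∣.∣ Δ m
  ∣Δ {p} {m} p∣B = ℤ∣.∣n⇒∣m*n (+ 32) (subst (+ (p ℕ.* p) ℤ∣.∣_) (ℤₚ.pos-* (B m) (B m)) (∣ᵤ⇒∣ (ℕ∣.*-pres-∣ p∣B p∣B)))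

  module _ {p q m Q : ℕ} .{{_ : NonZero m}} (pp : Prime p) (pq : Prime q)
           (p∣B : p ∣ B m) (p∣Q : p ∣ Q) (BQ : B (q ℕ.* m) ≡ B m ℕ.* Q) where

    private
      instance
        _ = B-nonZero m

      cancel : ∀ {z} → b (q ℕ.* m) ≡ b m * z → + Q ≡ z
      cancel {z} eq = ℤₚ.*-cancelˡ-≡ (b m) (+ Q) z (trans (sym (trans (cong +_ BQ) (ℤₚ.pos-* (B m) Q))) eq)

      p∣Δ : + p ℤ∣.∣ Δ m
      p∣Δ = ℤ∣.∣-trans (∣ᵤ⇒∣ (ℕ∣.m∣m*n p)) (∣Δ {p} {m} p∣B)

      Goal : Set
      Goal = p ≡ q × ¬ p ℕ.* p ∣ Q

      -- `b-multiples` gives Q = q + `Δ m` · x, and p² ∣ `Δ m`, so p and p² can divide Q only if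
      -- they divide q.
      odd : ∀ j → q ≡ suc (j ℕ.* 2) → Goal
      odd j q≡ = p≡q , λ p²∣Q → p²∤p pp (subst (p ℕ.* p ∣_) (sym p≡q) (∣⇒∣ᵤ (∣q (∣ᵤ⇒∣ p²∣Q) (∣Δ {p} {m} p∣B))))
        where
        Q≡ : ∃ λ x → + Q ≡ + q + Δ m * x
        Q≡ with b-multiples m j
        ... | x , _ , _ , eq = x , cancel (trans (cong (λ z → b (z ℕ.* m)) q≡) (trans eq (cong (λ z → b m * (+ z + Δ m * x)) (sym q≡))))
        ∣q : ∀ {d} → d ℤ∣.∣ + Q → d ℤ∣.∣ Δ m → d ℤ∣.∣ + q
        ∣q d∣Q d∣Δ = ℤ∣.∣m+n∣n⇒∣m (subst (_ ℤ∣.∣_) (proj₂ Q≡) d∣Q) (ℤ∣.∣m⇒∣m*n (proj₁ Q≡) d∣Δ)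
        p≡q : p ≡ q
        p≡q = prime-∣-prime pp pq (∣⇒∣ᵤ (∣q (∣ᵤ⇒∣ p∣Q) p∣Δ))

      -- Here Q = `t m`, so Q² = 4 + `Δ m`, and p ∣ `Δ m` forces p ∣ 4.
      even : 2 ≡ q → Goal
      even 2≡q = trans p≡2 2≡q , λ p²∣Q → contradiction (subst (λ z → z ℕ.* z ∣ Q) p≡2 p²∣Q) 4∤Q
        where
        Q²≡ : + (Q ℕ.* Q) ≡ + 4 + Δ m
        Q²≡ = trans (ℤₚ.pos-* Q Q) (trans (cong₂ _*_ Q≡t Q≡t) (t² m))
          where
          Q≡t : + Q ≡ t m
          Q≡t = cancel (trans (cong (λ z → b (z ℕ.* m)) (sym 2≡q)) (b-double m))
        ∣4 : ∀ {d} → d ℤ∣.∣ + (Q ℕ.* Q) → d ℤ∣.∣ Δ m → d ℤ∣.∣ + 4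
        ∣4 d∣ d∣Δ = ℤ∣.∣m+n∣n⇒∣m (subst (_ ℤ∣.∣_) Q²≡ d∣) d∣Δ
        p≡2 : p ≡ 2
        p≡2 with euclidsLemma 2 2 pp (∣⇒∣ᵤ (∣4 (∣ᵤ⇒∣ (ℕ∣.∣m⇒∣m*n Q p∣Q)) p∣Δ))
        ... | inj₁ p∣2 = prime-∣-prime pp prime[2] p∣2
        ... | inj₂ p∣2 = prime-∣-prime pp prime[2] p∣2
        -- 16 divides 32 and hence `Δ m`, so 4 ∣ Q would give 16 ∣ 4.
        4∤Q : ¬ 4 ∣ Q
        4∤Q 4∣Q with () ← toWitnessFalse {a? = 16 ℕ∣.∣? 4} _ (∣⇒∣ᵤ (∣4 {+ 16} (∣ᵤ⇒∣ (ℕ∣.*-pres-∣ 4∣Q 4∣Q))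
                            (ℤ∣.∣m⇒∣m*n {+ 16} {+ 32} (b m * b m) (∣ᵤ⇒∣ (ℕ∣.divides 2 refl)))))

    prime-∣-B∧quotient : p ≡ q × ¬ p ℕ.* p ∣ Q
    prime-∣-B∧quotient with 2∣⊎odd q
    ... | inj₁ 2∣q       = even (prime-∣-prime prime[2] pq 2∣q)
    ... | inj₂ (j , q≡) = odd j q≡

open import Data.Nat
open ℕₚ
open ℕ∣
open Identities using (B-add-suc; B-mono-∣; ∣B-gcd; prime-∣-B∧quotient)

-- The multiplicative structure of the sequence

lcm-mono-∣ : ∀ {a b c d} → a ∣ c → b ∣ d → lcm a b ∣ lcm c d
lcm-mono-∣ {c = c} {d} a∣c b∣d = lcm-least (∣-trans a∣c (m∣lcm[m,n] c d)) (∣-trans b∣d (n∣lcm[m,n] c d))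

∣*gcd : ∀ {k} x a c → k ∣ x * a → k ∣ x * c → k ∣ x * gcd a c
∣*gcd {k} x a c k∣xa k∣xc = subst (k ∣_) (sym (c*gcd[m,n]≡gcd[cm,cn] x a c)) (gcd-greatest k∣xa k∣xc)

gcd-nonZeroʳ : ∀ m n .{{_ : NonZero n}} → NonZero (gcd m n)
gcd-nonZeroʳ m n = ≢-nonZero λ eq → ≢-nonZero⁻¹ n (gcd[m,n]≡0⇒n≡0 m eq)

-- One half of the distributivity of gcd over lcm. After multiplication by g the claim is that
-- `k * g` divides `gcd a y * gcd c y`, which holds because it divides each of ac, ay, yc and yy.
∣lcm-gcd : ∀ {k} a c y .{{_ : NonZero y}} → k ∣ lcm a c → k ∣ y → k ∣ lcm (gcd a y) (gcd c y)
∣lcm-gcd {k} a c y k∣l k∣y =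
  *-cancelˡ-∣ g (subst₂ _∣_ (*-comm k g) (sym (gcd*lcm (gcd a y) (gcd c y))) kg∣AC)
  where
  g = gcd (gcd a y) (gcd c y)
  instance
    _ = gcd-nonZeroʳ c y
    _ = gcd-nonZeroʳ (gcd a y) (gcd c y)
  g∣a : g ∣ a
  g∣a = ∣-trans (gcd[m,n]∣m (gcd a y) (gcd c y)) (gcd[m,n]∣m a y)
  g∣c : g ∣ c
  g∣c = ∣-trans (gcd[m,n]∣n (gcd a y) (gcd c y)) (gcd[m,n]∣m c y)
  g∣y : g ∣ y
  g∣y = ∣-trans (gcd[m,n]∣n (gcd a y) (gcd c y)) (gcd[m,n]∣n c y)
  kg∣ac : k * g ∣ a * c
  kg∣ac = subst (k * g ∣_) (trans (*-comm (lcm a c) (gcd a c)) (gcd*lcm a c)) (*-pres-∣ k∣l (gcd-greatest g∣a g∣c))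
  kg∣y* : ∀ {z} → g ∣ z → k * g ∣ y * z
  kg∣y* = *-pres-∣ k∣y
  kg∣a*C : k * g ∣ a * gcd c y
  kg∣a*C = ∣*gcd a c y kg∣ac (subst (k * g ∣_) (*-comm y a) (kg∣y* g∣a))
  kg∣y*C : k * g ∣ y * gcd c y
  kg∣y*C = ∣*gcd y c y (kg∣y* g∣c) (kg∣y* g∣y)
  kg∣AC : k * g ∣ gcd a y * gcd c y
  kg∣AC = subst (k * g ∣_) (*-comm (gcd c y) (gcd a y))
    (∣*gcd (gcd c y) a y (subst (k * g ∣_) (*-comm a (gcd c y)) kg∣a*C) (subst (k * g ∣_) (*-comm y (gcd c y)) kg∣y*C))

-- The primes are accumulated in m so that, for d = `N (q ∷ S) m`, both d and d/q are values of
-- `N S`, at `q * m` and at `m`. Inductions over S therefore vary m.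
N : List ℕ → ℕ → ℕ
N []      m = m
N (q ∷ S) m = N S (q * m)

-- G S m is the lcm of the B(d/q) for q ∈ S, where d = N S m = m · ∏ S.
G : List ℕ → ℕ → ℕ
G []      m = 1
G (q ∷ S) m = lcm (G S (q * m)) (B (N S m))

N-* : ∀ S x m → N S (x * m) ≡ x * N S m
N-* []      x m = refl
N-* (q ∷ S) x m = trans (cong (N S) (swap q x m)) (N-* S x (q * m))
  where
  swap : ∀ q x m → q * (x * m) ≡ x * (q * m)
  swap = solve-∀

N≡ : ∀ S m → N S m ≡ product S * m
N≡ []      m = sym (+-identityʳ m)
N≡ (q ∷ S) m = trans (N≡ S (q * m)) (swap (product S) q m)
  where
  swap : ∀ P q m → P * (q * m) ≡ q * P * m
  swap = solve-∀

BN∣BN : ∀ S q m → B (N S m) ∣ B (N S (q * m))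
BN∣BN S q m = B-mono-∣ (divides q (N-* S q m))

G∣B : ∀ S m → G S m ∣ B (N S m)
G∣B []      m = 1∣ _
G∣B (q ∷ S) m = lcm-least (G∣B S (q * m)) (BN∣BN S q m)

B/q∣G : ∀ {S q} m → q ∈ S → ∃ λ d → N S m ≡ q * d × B d ∣ G S m
B/q∣G {q ∷ S} m (here refl) = N S m , N-* S q m , n∣lcm[m,n] (G S (q * m)) _
B/q∣G {q ∷ S} m (there q∈S) with B/q∣G (q * m) q∈S
... | d , eq , Bd∣G = d , eq , ∣-trans Bd∣G (m∣lcm[m,n] _ (B (N S m)))

G-mono-∣ : ∀ S x m → G S m ∣ G S (x * m)
G-mono-∣ []      x m = ∣-refl
G-mono-∣ (q ∷ S) x m = lcm-mono-∣
  (subst (λ z → G S (q * m) ∣ G S z) (swap x q m) (G-mono-∣ S x (q * m)))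
  (BN∣BN S x m)
  where
  swap : ∀ x q m → x * (q * m) ≡ q * (x * m)
  swap = solve-∀

N-nonZero : ∀ {S} m → All Prime S → .{{_ : NonZero m}} → NonZero (N S m)
N-nonZero (suc m) []        = _
N-nonZero {q ∷ S} m (pq ∷ ps) = N-nonZero (q * m) ps {{m*n≢0 q m {{prime⇒nonZero pq}}}}

-- Let d = `N S m`. By `∣lcm-gcd` each entry B(xd/q) of the lcm can be treated separately. What it
-- shares with B(d) divides B(gcd(xd/q, d)), and gcd(xd/q, d) = d/q because x is coprime to q.
∣G-descend : ∀ {k S} x m .{{_ : NonZero m}} → All Prime S → All (Coprime x) S →
             k ∣ G S (x * m) → k ∣ B (N S m) → k ∣ G S m
∣G-descend x m []        []       k∣ _ = k∣
∣G-descend {k} {q ∷ S} x m (pq ∷ ps) (c ∷ cs) k∣lcm k∣B =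
  ∣-trans (∣lcm-gcd a y z {{B-nonZero _ {{N-nonZero (q * m) ps}}}} k∣lcm k∣B)
          (lcm-mono-∣ (∣G-descend x (q * m) ps cs (subst (λ w → gcd a z ∣ G S w) (swap q x m) (gcd[m,n]∣m a z)) (gcd[m,n]∣n a z))
                      (subst (λ w → gcd y z ∣ B w) gcd≡ (∣B-gcd (N S (x * m)) (N S (q * m)) (gcd[m,n]∣m y z) (gcd[m,n]∣n y z))))
  where
  instance
    _ = m*n≢0 q m {{prime⇒nonZero pq}}
  a y z : ℕ
  a = G S (q * (x * m))
  y = B (N S (x * m))
  z = B (N S (q * m))
  swap : ∀ q x m → q * (x * m) ≡ x * (q * m)
  swap = solve-∀
  gcd≡ : gcd (N S (x * m)) (N S (q * m)) ≡ N S m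
  gcd≡ = begin
    gcd (N S (x * m)) (N S (q * m))  ≡⟨ cong₂ gcd (trans (N-* S x m) (*-comm x _)) (trans (N-* S q m) (*-comm q _)) ⟩
    gcd (N S m * x) (N S m * q)      ≡⟨ sym (c*gcd[m,n]≡gcd[cm,cn] (N S m) x q) ⟩
    N S m * gcd x q                  ≡⟨ cong (N S m *_) (coprime⇒gcd≡1 c) ⟩
    N S m * 1                        ≡⟨ *-identityʳ _ ⟩
    N S m                            ∎
    where open ≡-Reasoning

-- When S is the set of prime divisors of d = N S m, this is the homogenised cyclotomic value
-- Φ_d(α, β), where α and β are the roots of X² − 6X + 1.
F : List ℕ → ℕ → ℕ
F S m = quotient (G∣B S m)

B≡F*G : ∀ S m → B (N S m) ≡ F S m * G S m
B≡F*G S m = m∣n⇒n≡quotient*m (G∣B S m)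

∣-nonZero : ∀ {m n} → m ∣ n → .{{_ : NonZero n}} → NonZero m
∣-nonZero (divides c refl) = m*n≢0⇒n≢0 c

-- The counterpart of Φ_n(X^q) = Φ_qn(X) · Φ_n(X) for q ∤ n. By `∣G-descend` the gcd of
-- `G S (q * m)` and `B (N S m)` is `G S m`, which determines their lcm.
F-step : ∀ {S} q m .{{_ : NonZero m}} → Prime q → All Prime S → All (Coprime q) S →
         F S (q * m) ≡ F (q ∷ S) m * F S m
F-step {S} q m pq ps cs = *-cancelʳ-≡ _ _ Gq {{Gq≢0}} (begin
  F S (q * m) * Gq                 ≡⟨ sym (B≡F*G S (q * m)) ⟩
  B (N S (q * m))                  ≡⟨ B≡F*G (q ∷ S) m ⟩
  F (q ∷ S) m * lcm Gq Y           ≡⟨ cong (F (q ∷ S) m *_) lcm≡ ⟩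
  F (q ∷ S) m * (F S m * Gq)       ≡⟨ sym (*-assoc (F (q ∷ S) m) (F S m) Gq) ⟩
  F (q ∷ S) m * F S m * Gq         ∎)
  where
  open ≡-Reasoning
  Gq Gm Y : ℕ
  Gq = G S (q * m)
  Gm = G S m
  Y  = B (N S m)
  instance
    _ = m*n≢0 q m {{prime⇒nonZero pq}}
  Gq≢0 : NonZero Gq
  Gq≢0 = ∣-nonZero (G∣B S (q * m)) {{B-nonZero _ {{N-nonZero (q * m) ps}}}}
  Gm≢0 : NonZero Gm
  Gm≢0 = ∣-nonZero (G∣B S m) {{B-nonZero _ {{N-nonZero m ps}}}}
  gcd≡ : gcd Gq Y ≡ Gm
  gcd≡ = ∣-antisym (∣G-descend q m ps cs (gcd[m,n]∣m Gq Y) (gcd[m,n]∣n Gq Y))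
                   (gcd-greatest (G-mono-∣ S q m) (G∣B S m))
  swap : ∀ g f h → g * (f * h) ≡ h * (f * g)
  swap = solve-∀
  lcm≡ : lcm Gq Y ≡ F S m * Gq
  lcm≡ = *-cancelˡ-≡ _ _ Gm {{Gm≢0}} (begin
    Gm * lcm Gq Y         ≡⟨ cong (_* lcm Gq Y) (sym gcd≡) ⟩
    gcd Gq Y * lcm Gq Y   ≡⟨ gcd*lcm Gq Y ⟩
    Gq * Y                ≡⟨ cong (Gq *_) (B≡F*G S m) ⟩
    Gq * (F S m * Gm)     ≡⟨ swap Gq (F S m) Gm ⟩
    Gm * (F S m * Gq)     ∎)

-- Size estimates

5*B≤B : ∀ n → 5 * B n ≤ B (suc n)
5*B≤B zero    = z≤n
5*B≤B (suc n) = +-cancelʳ-≤ (B n) _ _ (begin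
  5 * B (suc n) + B n          ≤⟨ +-monoʳ-≤ (5 * B (suc n)) (B-mono n) ⟩
  5 * B (suc n) + B (suc n)    ≡⟨ +-comm (5 * B (suc n)) (B (suc n)) ⟩
  6 * B (suc n)                ≡⟨ sym (B-recurrence n) ⟩
  B (suc (suc n)) + B n        ∎)
  where open ≤-Reasoning

5^n≤B : ∀ n → 5 ^ n ≤ B (suc n)
5^n≤B zero    = ≤-refl
5^n≤B (suc n) = ≤-trans (*-monoʳ-≤ 5 (5^n≤B n)) (5*B≤B (suc n))

B-+≤ : ∀ n m → B (suc (n + m)) ≤ B (suc n) * B (suc m)
B-+≤ n m = subst (B (suc (n + m)) ≤_) (B-add-suc n m) (m≤m+n _ _)

-- The error term `B n * B m` of `B-add-suc` is at most half of the product, since 5B(n) ≤ B(n + 1).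
B*B≤ : ∀ n m → B (suc n) * B (suc m) ≤ 2 * B (suc (n + m))
B*B≤ n m = +-cancelʳ-≤ (B (suc n) * B (suc m)) _ _ (begin
  B (suc n) * B (suc m) + B (suc n) * B (suc m)
    ≡⟨ cong (λ z → z + z) (sym (B-add-suc n m)) ⟩
  (B (suc (n + m)) + B n * B m) + (B (suc (n + m)) + B n * B m)
    ≡⟨ regroup (B (suc (n + m))) (B n * B m) ⟩
  2 * B (suc (n + m)) + 2 * (B n * B m)
    ≤⟨ +-monoʳ-≤ (2 * B (suc (n + m))) 2BB≤ ⟩
  2 * B (suc (n + m)) + B (suc n) * B (suc m) ∎)
  where
  open ≤-Reasoning
  regroup : ∀ x y → (x + y) + (x + y) ≡ 2 * x + 2 * y
  regroup = solve-∀
  2BB≤ : 2 * (B n * B m) ≤ B (suc n) * B (suc m)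
  2BB≤ = begin
    2 * (B n * B m)       ≡⟨ sym (*-assoc 2 (B n) (B m)) ⟩
    2 * B n * B m         ≤⟨ *-mono-≤ (≤-trans (*-monoˡ-≤ (B n) 2≤5) (5*B≤B n)) (B-mono m) ⟩
    B (suc n) * B (suc m) ∎
    where
    2≤5 : 2 ≤ 5
    2≤5 = s≤s (s≤s z≤n)

-- X lies between αᵉ/lo and up·αᵉ; the irrational αᵉ is replaced by the ratios B(1+n+e)/B(1+n).
record Approx (lo up X e : ℕ) : Set where
  field
    lower : ∀ n → B (suc (n + e)) ≤ lo * (X * B (suc n))
    upper : ∀ n → X * B (suc n) ≤ up * B (suc (n + e))

open Approx

Approx-B : ∀ e → Approx 1 2 (B (suc e)) e
lower (Approx-B e) n = subst (B (suc (n + e)) ≤_) (trans (*-comm (B (suc n)) (B (suc e))) (sym (*-identityˡ _))) (B-+≤ n e)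
upper (Approx-B e) n = subst (_≤ 2 * B (suc (n + e))) (*-comm (B (suc n)) (B (suc e))) (B*B≤ n e)

-- Division works because the bounds hold for every n: the bound for Z is taken at n + e and the one
-- for YZ at n, and both involve B(1 + n + e + f).
Approx-cancel : ∀ {lo up lo′ up′ Y Z} e f .{{_ : NonZero Z}} →
  Approx lo up (Y * Z) (e + f) → Approx lo′ up′ Z f → Approx (lo * up′) (up * lo′) Y e
lower (Approx-cancel {lo} {up} {lo′} {up′} {Y} {Z} e f AX AZ) n = *-cancelˡ-≤ Z (begin
  Z * B (suc (n + e))                  ≤⟨ upper AZ (n + e) ⟩
  up′ * B (suc (n + e + f))            ≡⟨ cong (λ z → up′ * B (suc z)) (+-assoc n e f) ⟩
  up′ * B (suc (n + (e + f)))          ≤⟨ *-monoʳ-≤ up′ (lower AX n) ⟩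
  up′ * (lo * (Y * Z * B (suc n)))     ≡⟨ regroup up′ lo Y Z (B (suc n)) ⟩
  Z * (lo * up′ * (Y * B (suc n)))     ∎)
  where
  open ≤-Reasoning
  regroup : ∀ u l y z w → u * (l * (y * z * w)) ≡ z * (l * u * (y * w))
  regroup = solve-∀
upper (Approx-cancel {lo} {up} {lo′} {up′} {Y} {Z} e f AX AZ) n = *-cancelˡ-≤ Z (begin
  Z * (Y * B (suc n))                       ≡⟨ regroup₁ Z Y (B (suc n)) ⟩
  Y * Z * B (suc n)                         ≤⟨ upper AX n ⟩
  up * B (suc (n + (e + f)))                ≡⟨ cong (λ z → up * B (suc z)) (sym (+-assoc n e f)) ⟩
  up * B (suc (n + e + f))                  ≤⟨ *-monoʳ-≤ up (lower AZ (n + e)) ⟩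
  up * (lo′ * (Z * B (suc (n + e))))        ≡⟨ regroup₂ up lo′ Z (B (suc (n + e))) ⟩
  Z * (up * lo′ * B (suc (n + e)))          ∎)
  where
  open ≤-Reasoning
  regroup₁ : ∀ z y w → z * (y * w) ≡ y * z * w
  regroup₁ = solve-∀
  regroup₂ : ∀ u l z w → u * (l * (z * w)) ≡ z * (u * l * w)
  regroup₂ = solve-∀

-- Euler's totient of ∏ S when S consists of distinct primes.
φ : List ℕ → ℕ
φ []      = 1
φ (q ∷ S) = pred q * φ S

-- The constants that iterating `Approx-cancel` produces; for non-empty S both equal 2^(2^(|S| -
-- 1)).
lo up : List ℕ → ℕ
lo []      = 1
lo (q ∷ S) = lo S * up S
up []      = 2
up (q ∷ S) = up S * lo S

-- F S m has the order of magnitude of α^(E S m); the case of [] differs because B(m) ≈ α^(m − 1).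
E : List ℕ → ℕ → ℕ
E []      m = pred m
E (q ∷ S) m = φ (q ∷ S) * m

E-step : ∀ S q m .{{_ : NonZero q}} .{{_ : NonZero m}} → E S (q * m) ≡ E (q ∷ S) m + E S m
E-step []      (suc q) (suc m) = identity q m
  where
  identity : ∀ q m → m + q * suc m ≡ q * 1 * suc m + m
  identity = solve-∀
E-step (r ∷ S) (suc q) m       = identity (pred r) (φ S) q m
  where
  identity : ∀ r f q m → r * f * (suc q * m) ≡ q * (r * f) * m + r * f * m
  identity = solve-∀

F-nonZero : ∀ S m .{{_ : NonZero m}} → All Prime S → NonZero (F S m)
F-nonZero S m ps = ≢-nonZero λ F≡0 →
  ≢-nonZero⁻¹ (B (N S m)) {{B-nonZero _ {{N-nonZero m ps}}}} (trans (B≡F*G S m) (cong (_* G S m) F≡0))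

-- Inclusion-exclusion one prime at a time: by `F-step`, `F (q ∷ S) m` is the quotient of
-- `F S (q * m)` by `F S m`, so the bounds divide, starting from `F [] m` = B(m).
F-approx : ∀ {S} m .{{_ : NonZero m}} → All Prime S → AllPairs Coprime S →
           Approx (lo S) (up S) (F S m) (E S m)
F-approx (suc m) [] [] = subst (λ z → Approx 1 2 z m) (trans (B≡F*G [] (suc m)) (*-identityʳ _)) (Approx-B m)
F-approx {q ∷ S} m (pq ∷ ps) (c ∷ cs) = Approx-cancel (E (q ∷ S) m) (E S m) {{F-nonZero S m ps}}
  (subst₂ (Approx (lo S) (up S)) (F-step q m pq ps c) (E-step S q m) (F-approx (q * m) ps cs))
  (F-approx m ps cs)
  where
  instance
    _ = prime⇒nonZero pq
    _ = m*n≢0 q m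

5^φ≤F : ∀ {q S} m .{{_ : NonZero m}} → All Prime (q ∷ S) → AllPairs Coprime (q ∷ S) →
        5 ^ φ (q ∷ S) ≤ lo (q ∷ S) * F (q ∷ S) m
5^φ≤F {q} {S} m ps cs = begin
  5 ^ φ (q ∷ S)                      ≤⟨ ^-monoʳ-≤ 5 (m≤m*n (φ (q ∷ S)) m) ⟩
  5 ^ (φ (q ∷ S) * m)                ≤⟨ 5^n≤B (φ (q ∷ S) * m) ⟩
  B (suc (φ (q ∷ S) * m))            ≤⟨ lower (F-approx m ps cs) 0 ⟩
  lo (q ∷ S) * (F (q ∷ S) m * 1)     ≡⟨ cong (lo (q ∷ S) *_) (*-identityʳ (F (q ∷ S) m)) ⟩
  lo (q ∷ S) * F (q ∷ S) m           ∎
  where open ≤-Reasoning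

-- A further prime q squares `lo S * up S`, but raises `2 ^ φ S` to the power q - 1 ≥ 2.
lo*up≤2^φ : ∀ {S} → All (3 ≤_) S → lo S * up S ≤ 2 ^ φ S
lo*up≤2^φ []                    = ≤-refl
lo*up≤2^φ {suc (suc (suc j)) ∷ S} (s≤s (s≤s (s≤s _)) ∷ ≥3) = begin
  lo S * up S * (up S * lo S)     ≡⟨ cong (lo S * up S *_) (*-comm (up S) (lo S)) ⟩
  lo S * up S * (lo S * up S)     ≤⟨ *-mono-≤ (lo*up≤2^φ ≥3) (lo*up≤2^φ ≥3) ⟩
  2 ^ φ S * 2 ^ φ S               ≡⟨ sym (^-distribˡ-+-* 2 (φ S) (φ S)) ⟩
  2 ^ (φ S + φ S)                 ≤⟨ ^-monoʳ-≤ 2 (+-monoʳ-≤ (φ S) (m≤m+n (φ S) (j * φ S))) ⟩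
  2 ^ ((2 + j) * φ S)             ∎
  where open ≤-Reasoning

product≥3 : ∀ {q S} → All (3 ≤_) (q ∷ S) → 3 ≤ product (q ∷ S)
product≥3 {q} {[]}    (q≥3 ∷ [])  = ≤-trans q≥3 (≤-reflexive (sym (*-identityʳ q)))
product≥3 {q} {r ∷ S} (q≥3 ∷ ≥3) = ≤-trans q≥3 (m≤m*n q _ {{>-nonZero (≤-trans (s≤s z≤n) (product≥3 ≥3))}})

^-distribʳ-* : ∀ o m n → (m * n) ^ o ≡ m ^ o * n ^ o
^-distribʳ-* zero    m n = refl
^-distribʳ-* (suc o) m n = trans (cong (m * n *_) (^-distribʳ-* o m n)) (interchange m n (m ^ o) (n ^ o))
  where
  interchange : ∀ m n x y → m * n * (x * y) ≡ m * x * (n * y)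
  interchange = solve-∀

-- Applied with q = 3 + j, in the form x · q ≤ x^(q - 1).
3+j≤x^1+j : ∀ {x} j → 3 ≤ x → 3 + j ≤ x ^ (1 + j)
3+j≤x^1+j {x} zero    x≥3 = ≤-trans x≥3 (≤-reflexive (sym (*-identityʳ x)))
3+j≤x^1+j {x} (suc j) x≥3 = begin
  4 + j                     ≤⟨ m≤m+n (4 + j) (5 + 2 * j) ⟩
  4 + j + (5 + 2 * j)       ≡⟨ identity j ⟩
  3 * (3 + j)               ≤⟨ *-mono-≤ x≥3 (3+j≤x^1+j j x≥3) ⟩
  x * x ^ (1 + j)           ∎
  where
  open ≤-Reasoning
  identity : ∀ j → 4 + j + (5 + 2 * j) ≡ 3 * (3 + j)
  identity = solve-∀

-- This is 2∏q < (5/2)^φ without division. A further prime q multiplies the left side by q and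
-- raises the right side to the power q - 1. The factor 2 is kept for the prime 2, which doubles the
-- product and leaves φ unchanged.
2*product*2^φ<5^φ : ∀ {q S} → All (3 ≤_) (q ∷ S) →
                    2 * product (q ∷ S) * 2 ^ φ (q ∷ S) < 5 ^ φ (q ∷ S)
2*product*2^φ<5^φ {suc (suc (suc j))} {[]} (s≤s (s≤s (s≤s _)) ∷ []) =
  subst₂ (λ q e → 2 * q * 2 ^ e < 5 ^ e) (sym (*-identityʳ (3 + j))) (sym (*-identityʳ (2 + j))) (go j)
  where
  open ≤-Reasoning
  identity₁ : ∀ j x → 2 * (4 + j) * (2 * x) + 4 * (2 + j) * x ≡ 4 * (2 * (3 + j) * x)
  identity₁ = solve-∀
  go : ∀ j → 2 * (3 + j) * 2 ^ (2 + j) < 5 ^ (2 + j)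
  -- The case q = 3 is tight: 24 < 25.
  go zero    = ≤-refl
  go (suc j) = begin-strict
    -- The left side grows by at most 4 per step and the right side by 5; the added term makes the
    -- growth exactly 4.
    2 * (4 + j) * (2 * 2 ^ (2 + j))                               ≤⟨ m≤m+n _ (4 * (2 + j) * 2 ^ (2 + j)) ⟩
    2 * (4 + j) * (2 * 2 ^ (2 + j)) + 4 * (2 + j) * 2 ^ (2 + j)   ≡⟨ identity₁ j (2 ^ (2 + j)) ⟩
    4 * (2 * (3 + j) * 2 ^ (2 + j))                               <⟨ *-monoʳ-< 4 (go j) ⟩
    4 * 5 ^ (2 + j)                                               ≤⟨ *-monoˡ-≤ (5 ^ (2 + j)) (n≤1+n 4) ⟩
    5 * 5 ^ (2 + j)                                               ∎
2*product*2^φ<5^φ {suc (suc (suc j))} {r ∷ S} (s≤s (s≤s (s≤s _)) ∷ ≥3) = begin-strict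
  2 * ((3 + j) * R) * 2 ^ ((2 + j) * f)           ≡⟨ identity (3 + j) R (2 ^ ((2 + j) * f)) ⟩
  2 * R * (3 + j) * 2 ^ ((2 + j) * f)             ≤⟨ *-monoˡ-≤ (2 ^ ((2 + j) * f)) (*-monoʳ-≤ (2 * R) (3+j≤x^1+j j 3≤2R)) ⟩
  (2 * R) ^ (2 + j) * 2 ^ ((2 + j) * f)           ≡⟨ cong ((2 * R) ^ (2 + j) *_) (^-swap 2) ⟩
  (2 * R) ^ (2 + j) * (2 ^ f) ^ (2 + j)           ≡⟨ sym (^-distribʳ-* (2 + j) (2 * R) (2 ^ f)) ⟩
  (2 * R * 2 ^ f) ^ (2 + j)                       <⟨ ^-monoˡ-< (2 + j) (2*product*2^φ<5^φ ≥3) ⟩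
  (5 ^ f) ^ (2 + j)                               ≡⟨ sym (^-swap 5) ⟩
  5 ^ ((2 + j) * f)                               ∎
  where
  open ≤-Reasoning
  R f : ℕ
  R = product (r ∷ S)
  f = φ (r ∷ S)
  3≤2R : 3 ≤ 2 * R
  3≤2R = ≤-trans (product≥3 ≥3) (m≤n*m R 2)
  identity : ∀ q R y → 2 * (q * R) * y ≡ 2 * R * q * y
  identity = solve-∀
  ^-swap : ∀ x → x ^ ((2 + j) * f) ≡ (x ^ f) ^ (2 + j)
  ^-swap x = trans (cong (x ^_) (*-comm (2 + j) f)) (sym (^-*-assoc x f (2 + j)))

product<F-odd : ∀ {q S} m .{{_ : NonZero m}} → All Prime (q ∷ S) → AllPairs Coprime (q ∷ S) →
                All (3 ≤_) (q ∷ S) → product (q ∷ S) < F (q ∷ S) m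
product<F-odd {q} {S} m ps cs ≥3 = *-cancelʳ-< (2 ^ φ T) _ _ (begin-strict
  product T * 2 ^ φ T        ≤⟨ *-monoˡ-≤ (2 ^ φ T) (m≤n*m (product T) 2) ⟩
  2 * product T * 2 ^ φ T    <⟨ 2*product*2^φ<5^φ ≥3 ⟩
  5 ^ φ T                    ≤⟨ 5^φ≤F m ps cs ⟩
  lo T * F T m               ≤⟨ *-monoˡ-≤ (F T m) (≤-trans (m≤m*n (lo T) (up T) {{up≢0 T}}) (lo*up≤2^φ ≥3)) ⟩
  2 ^ φ T * F T m            ≡⟨ *-comm (2 ^ φ T) (F T m) ⟩
  F T m * 2 ^ φ T            ∎)
  where
  open ≤-Reasoning
  T = q ∷ S
  lo≢0 : ∀ S → NonZero (lo S)
  up≢0 : ∀ S → NonZero (up S)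
  lo≢0 []      = _
  lo≢0 (_ ∷ S) = m*n≢0 (lo S) (up S) {{lo≢0 S}} {{up≢0 S}}
  up≢0 []      = _
  up≢0 (_ ∷ S) = m*n≢0 (up S) (lo S) {{up≢0 S}} {{lo≢0 S}}

-- `lo*up≤2^φ` does not extend over the prime 2, where q - 1 = 1. With 2 at the head, `lo (2 ∷ S)`
-- unfolds to `lo S * up S`, so that bound is needed for the odd primes only.
product<F-even : ∀ {S} m .{{_ : NonZero m}} → All Prime (2 ∷ S) → AllPairs Coprime (2 ∷ S) →
                All (3 ≤_) S → product (2 ∷ S) < F (2 ∷ S) m
product<F-even {S} m ps cs ≥3 = *-cancelʳ-< (2 ^ φ S) _ _ (begin-strict
  2 * product S * 2 ^ φ S      <⟨ bound ≥3 ⟩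
  5 ^ φ S                      ≡⟨ cong (5 ^_) (sym (*-identityˡ (φ S))) ⟩
  5 ^ φ (2 ∷ S)                ≤⟨ 5^φ≤F m ps cs ⟩
  lo S * up S * F (2 ∷ S) m    ≤⟨ *-monoˡ-≤ (F (2 ∷ S) m) (lo*up≤2^φ ≥3) ⟩
  2 ^ φ S * F (2 ∷ S) m        ≡⟨ *-comm (2 ^ φ S) (F (2 ∷ S) m) ⟩
  F (2 ∷ S) m * 2 ^ φ S        ∎)
  where
  open ≤-Reasoning
  bound : ∀ {S} → All (3 ≤_) S → 2 * product S * 2 ^ φ S < 5 ^ φ S
  bound []         = ≤-refl
  bound (q ∷ ≥3′) = 2*product*2^φ<5^φ (q ∷ ≥3′)

-- Primitive prime divisors

∃-prime-∣ : ∀ n → 1 < n → ∃ λ p → Prime p × p ∣ n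
∃-prime-∣ n 1<n with factorise n {{>-nonZero (<⇒≤ 1<n)}}
... | record { factors = [] ; isFactorisation = eq } = contradiction 1<n (<-irrefl (sym eq))
... | record { factors = p ∷ ps ; isFactorisation = eq ; factorsPrime = pp ∷ _ } =
  p , pp , subst (p ∣_) (sym eq) (m∣m*n (product ps))

-- Otherwise F would be squarefree with all prime factors in S, hence at most ∏ S. The induction
-- cancels q from F and from the product together.
∃-prime-∉⊎²∣ : ∀ S F → All Prime S → product S < F → ∃ λ p → Prime p × p ∣ F × (p ∉ S ⊎ p * p ∣ F)
∃-prime-∉⊎²∣ [] F [] 1<F with ∃-prime-∣ F 1<F
... | p , pp , p∣F = p , pp , p∣F , inj₁ λ ()
∃-prime-∉⊎²∣ (q ∷ S) F (pq ∷ ps) lt with q ∣? F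
... | no q∤F with ∃-prime-∉⊎²∣ S F ps (≤-<-trans (m≤n*m (product S) q {{prime⇒nonZero pq}}) lt)
...   | p , pp , p∣F , inj₂ p²∣F = p , pp , p∣F , inj₂ p²∣F
...   | p , pp , p∣F , inj₁ p∉S  = p , pp , p∣F , inj₁ λ
  { (here refl) → q∤F p∣F ; (there p∈S) → p∉S p∈S }
∃-prime-∉⊎²∣ (q ∷ S) F (pq ∷ ps) lt | yes (divides F′ refl)
    with ∃-prime-∉⊎²∣ S F′ ps (*-cancelˡ-< q _ _ (subst (q * product S <_) (*-comm F′ q) lt))
...   | p , pp , p∣F′ , inj₂ p²∣F′ = p , pp , ∣m⇒∣m*n q p∣F′ , inj₂ (∣m⇒∣m*n q p²∣F′)
...   | p , pp , p∣F′ , inj₁ p∉S with p ≟ q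
...     | yes refl = p , pp , ∣m⇒∣m*n q p∣F′ , inj₂ (*-monoˡ-∣ p p∣F′)
...     | no p≢q   = p , pp , ∣m⇒∣m*n q p∣F′ , inj₁ λ
  { (here p≡q) → p≢q p≡q ; (there p∈S) → p∉S p∈S }

distinct-primes-coprime : ∀ {p q} → Prime p → Prime q → p ≢ q → Coprime p q
distinct-primes-coprime pp pq p≢q (d∣p , d∣q) with prime⇒irreducible pp d∣p
... | inj₁ d≡1  = d≡1
... | inj₂ refl = contradiction (prime-∣-prime pp pq d∣q) p≢q

primes-coprime : ∀ {S} → All Prime S → Unique S → AllPairs Coprime S
primes-coprime []        []       = []
primes-coprime {p ∷ S} (pp ∷ ps) (u ∷ us) = head ps u ∷ primes-coprime ps us
  where
  head : ∀ {S} → All Prime S → All (p ≢_) S → All (Coprime p) S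
  head []        []        = []
  head (pq ∷ ps) (p≢q ∷ u) = distinct-primes-coprime pp pq p≢q ∷ head ps u

product-primes-∣ : ∀ {S n} → All Prime S → Unique S → All (_∣ n) S → product S ∣ n
product-primes-∣ []        []       []       = 1∣ _
product-primes-∣ {p ∷ S} (pp ∷ ps) (u ∷ us) (p∣n ∷ S∣n) with product-primes-∣ ps us S∣n
... | divides c refl with euclidsLemma c (product S) pp p∣n
...   | inj₁ p∣c = *-monoˡ-∣ (product S) p∣c
...   | inj₂ p∣P = contradiction refl (All.lookup u (factorisationHasAllPrimeFactors pp p∣P ps))

Primitive : ℕ → ℕ → Set
Primitive d p = Prime p × p ∣ B d × (∀ e → e ∣ d → e < d → ¬ p ∣ B e)

-- Take q to be any prime factor of d/e. Primitivity thus only has to be tested against the B(d/q).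
proper-divisor : ∀ {e d} → e ∣ d → e < d → ∃ λ q → Prime q × q ∣ d × (∀ d′ → d ≡ q * d′ → e ∣ d′)
proper-divisor {e} {d} e∣d@(divides c refl) e<d with ∃-prime-∣ c (quotient>1 e∣d e<d)
... | q , pq , divides x refl = q , pq , ∣m⇒∣m*n e (n∣m*n x) , λ d′ eq → divides x
  (*-cancelˡ-≡ d′ (x * e) q {{prime⇒nonZero pq}} (trans (sym eq) (swap x q e)))
  where
  swap : ∀ x q e → x * q * e ≡ q * (x * e)
  swap = solve-∀

-- If p ∣ F were not primitive, it would divide some B(d/q) as well as B(d)/B(d/q). Then p = q ∈ S
-- and p² ∤ F, against the choice of p.
primitive-from : ∀ S m .{{_ : NonZero m}} → All Prime S → (∀ {q} → Prime q → q ∣ N S m → q ∈ S) →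
                 product S < F S m → ∃ (Primitive (N S m))
primitive-from S m ps complete P<F with ∃-prime-∉⊎²∣ S (F S m) ps P<F
... | p , pp , p∣F , alt = p , pp , ∣-trans p∣F (subst (F S m ∣_) (sym (B≡F*G S m)) (m∣m*n (G S m))) ,
  λ _ → absurd
  where
  absurd : ∀ {e} → e ∣ N S m → e < N S m → p ∣ B e → ⊥
  absurd e∣d e<d p∣Be with proper-divisor e∣d e<d
  ... | q , pq , q∣d , e∣d/q with complete pq q∣d
  ...   | q∈S with B/q∣G m q∈S
  ...     | d′ , d≡ , divides c G≡ = conclude alt
    where
    instance
      d′≢0 : NonZero d′
      d′≢0 = m*n≢0⇒n≢0 q {{subst NonZero d≡ (N-nonZero m ps)}}
    -- With G = c · B(d/q), the quotient B(d)/B(d/q) is F · c.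
    Bqd′≡ : B (q * d′) ≡ B d′ * (F S m * c)
    Bqd′≡ = trans (cong B (sym d≡)) (trans (B≡F*G S m) (trans (cong (F S m *_) G≡) (swap (F S m) c (B d′))))
      where
      swap : ∀ f c x → f * (c * x) ≡ x * (f * c)
      swap = solve-∀
    facts : p ≡ q × ¬ p * p ∣ F S m * c
    facts = prime-∣-B∧quotient pp pq (∣-trans p∣Be (B-mono-∣ (e∣d/q d′ d≡))) (∣m⇒∣m*n c p∣F) Bqd′≡
    conclude : p ∉ S ⊎ p * p ∣ F S m → ⊥
    conclude (inj₁ p∉S)  = p∉S (subst (_∈ S) (sym (proj₁ facts)) q∈S)
    conclude (inj₂ p²∣F) = proj₂ facts (∣m⇒∣m*n c p²∣F)

module _ (d : ℕ) (2≤d : 2 ≤ d) where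

  private
    instance
      d≢0 : NonZero d
      d≢0 = >-nonZero (<⇒≤ 2≤d)

    -- The candidates run from 3 to d + 2, which covers all odd divisors above 1. The prime 2 is
    -- kept apart because its size estimate differs.
    oddPrimes : List ℕ
    oddPrimes = filter (λ q → prime? q ×-dec q ∣? d) (map (3 +_) (upTo d))

    odd-good : All (λ q → Prime q × q ∣ d) oddPrimes
    odd-good = Allₚ.all-filter (λ q → prime? q ×-dec q ∣? d) (map (3 +_) (upTo d))

    odd-≥3 : All (3 ≤_) oddPrimes
    odd-≥3 = Allₚ.filter⁺ _ (Allₚ.map⁺ (All.universal (λ x → m≤m+n 3 x) (upTo d)))

    odd-unique : Unique oddPrimes
    odd-unique = Uniqueₚ.filter⁺ _ (Uniqueₚ.map⁺ (+-cancelˡ-≡ 3 _ _) (Uniqueₚ.upTo⁺ d))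

    odd-complete : ∀ {q} → Prime q → q ∣ d → q ≢ 2 → q ∈ oddPrimes
    odd-complete {0} pq _ _ = contradiction pq ¬prime[0]
    odd-complete {1} pq _ _ = contradiction pq ¬prime[1]
    odd-complete {2} _ _ q≢2 = contradiction refl q≢2
    odd-complete {suc (suc (suc j))} pq q∣d _ =
      ∈-filter⁺ _ (∈-map⁺ (3 +_) (∈-upTo⁺ (≤-trans (s≤s (m≤n+m j 2)) (∣⇒≤ q∣d)))) (pq , q∣d)

    build : ∀ S → All (λ q → Prime q × q ∣ d) S → Unique S → (∀ {q} → Prime q → q ∣ d → q ∈ S) →
            (∀ m .{{_ : NonZero m}} → All Prime S → AllPairs Coprime S → product S < F S m) → ∃ (Primitive d)
    build S good unique complete P<F with product-primes-∣ (All.map proj₁ good) unique (All.map proj₂ good)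
    ... | divides m d≡ = subst (λ z → ∃ (Primitive z)) N≡d
      (primitive-from S m ps (λ pq q∣ → complete pq (subst (_ ∣_) N≡d q∣)) (P<F m ps (primes-coprime ps unique)))
      where
      ps : All Prime S
      ps = All.map proj₁ good
      N≡d : N S m ≡ d
      N≡d = trans (N≡ S m) (trans (*-comm (product S) m) (sym d≡))
      instance
        m≢0 : NonZero m
        m≢0 = m*n≢0⇒m≢0 m {{subst NonZero d≡ d≢0}}

    build-odd : ¬ 2 ∣ d → ∃ (Primitive d)
    build-odd 2∤d = build oddPrimes odd-good odd-unique complete (nonempty oddPrimes complete odd-≥3)
      where
      complete : ∀ {q} → Prime q → q ∣ d → q ∈ oddPrimes
      complete pq q∣d = odd-complete pq q∣d λ { refl → 2∤d q∣d }
      nonempty : ∀ S → (∀ {q} → Prime q → q ∣ d → q ∈ S) → All (3 ≤_) S →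
                 ∀ m .{{_ : NonZero m}} → All Prime S → AllPairs Coprime S → product S < F S m
      -- The bound fails for S = [] and m = 1, so a prime divisor of d is used to exclude S = [].
      nonempty []      complete _ _ _ _ with ∃-prime-∣ d 2≤d
      ... | _ , pq , q∣d with () ← complete pq q∣d
      nonempty (_ ∷ _) _ ≥3 m ps cs = product<F-odd m ps cs ≥3

  ∃-primitive : ∃ (Primitive d)
  ∃-primitive with 2 ∣? d
  ... | no 2∤d  = build-odd 2∤d
  ... | yes 2∣d = build (2 ∷ oddPrimes) ((prime[2] , 2∣d) ∷ odd-good) (All.map <⇒≢ odd-≥3 ∷ odd-unique)
                        complete (λ m ps cs → product<F-even m ps cs odd-≥3)
    where
    complete : ∀ {q} → Prime q → q ∣ d → q ∈ 2 ∷ oddPrimes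
    complete {q} pq q∣d with q ≟ 2
    ... | yes q≡2 = here q≡2
    ... | no q≢2  = there (odd-complete pq q∣d q≢2)

-- p divides B(gcd(d, d′)), so by primitivity the gcd is a proper divisor of neither d nor d′.
primitive-injective : ∀ {d d′ p} → 2 ≤ d → 2 ≤ d′ → Primitive d p → Primitive d′ p → d ≡ d′
primitive-injective {d} {d′} {p} 2≤d 2≤d′ (_ , p∣d , prim) (_ , p∣d′ , prim′) = trans (sym g≡d) g≡d′
  where
  g = gcd d d′
  p∣g : p ∣ B g
  p∣g = ∣B-gcd d d′ p∣d p∣d′
  full : ∀ {d} → 2 ≤ d → g ∣ d → (∀ e → e ∣ d → e < d → ¬ p ∣ B e) → g ≡ d
  full {d} 2≤d g∣d prim with m≤n⇒m<n∨m≡n (∣⇒≤ {{>-nonZero (<⇒≤ 2≤d)}} g∣d)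
  ... | inj₁ g<d = contradiction p∣g (prim g g∣d g<d)
  ... | inj₂ g≡d = g≡d
  g≡d : g ≡ d
  g≡d = full 2≤d (gcd[m,n]∣m d d′) prim
  g≡d′ : g ≡ d′
  g≡d′ = full 2≤d′ (gcd[m,n]∣n d d′) prim′

-- Counting divisors

unique-⊆-length : ∀ {xs ys : List ℕ} → Unique xs → (∀ {x} → x ∈ xs → x ∈ ys) → length xs ≤ length ys
unique-⊆-length {[]}     []       _   = z≤n
unique-⊆-length {x ∷ xs} {ys} (u ∷ us) sub = begin
  suc (length xs)              ≤⟨ s≤s (unique-⊆-length us (λ {y} y∈xs → ∈-─ x∈ys (sub (there y∈xs)) (All.lookup u y∈xs))) ⟩
  suc (length (ys ─ x∈ys))     ≡⟨ length-─ x∈ys ⟩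
  length ys                    ∎
  where
  open ≤-Reasoning
  x∈ys : x ∈ ys
  x∈ys = sub (here refl)
  length-─ : ∀ {x : ℕ} {ys} (x∈ys : x ∈ ys) → suc (length (ys ─ x∈ys)) ≡ length ys
  length-─ (here _)  = refl
  length-─ (there i) = cong suc (length-─ i)
  ∈-─ : ∀ {x y : ℕ} {ys} (x∈ys : x ∈ ys) → y ∈ ys → x ≢ y → y ∈ (ys ─ x∈ys)
  ∈-─ (here refl) (here refl) x≢y = contradiction refl x≢y
  ∈-─ (here _)    (there j)   _   = j
  ∈-─ (there i)   (here eq)   _   = here eq
  ∈-─ (there i)   (there j)   x≢y = there (∈-─ i j x≢y)

∈-divisors : ∀ {k n} .{{_ : NonZero n}} → k ∣ n → k ∈ divisors n
∈-divisors {zero}  {n} 0∣n = contradiction (0∣⇒≡0 0∣n) (≢-nonZero⁻¹ n)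
∈-divisors {suc k} {n} k∣n = ∈-filter⁺ (_∣? n) (∈-map⁺ suc (∈-upTo⁺ (∣⇒≤ k∣n))) k∣n

subproducts : List ℕ → List ℕ
subproducts []       = 1 ∷ []
subproducts (p ∷ ps) = subproducts ps ++ map (p *_) (subproducts ps)

length-subproducts : ∀ ps → length (subproducts ps) ≡ 2 ^ length ps
length-subproducts []       = refl
length-subproducts (p ∷ ps) = begin
  length (subproducts ps ++ map (p *_) (subproducts ps))
    ≡⟨ length-++ (subproducts ps) ⟩
  length (subproducts ps) + length (map (p *_) (subproducts ps))
    ≡⟨ cong (length (subproducts ps) +_) (length-map (p *_) (subproducts ps)) ⟩
  length (subproducts ps) + length (subproducts ps)
    ≡⟨ cong (λ z → z + z) (length-subproducts ps) ⟩
  2 ^ length ps + 2 ^ length ps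
    ≡⟨ cong (2 ^ length ps +_) (sym (+-identityʳ _)) ⟩
  2 * 2 ^ length ps ∎
  where open ≡-Reasoning

subproducts-∣ : ∀ ps → All (_∣ product ps) (subproducts ps)
subproducts-∣ []       = ∣-refl ∷ []
subproducts-∣ (p ∷ ps) = Allₚ.++⁺ (All.map (∣n⇒∣m*n p) (subproducts-∣ ps))
                                  (Allₚ.map⁺ (All.map (*-monoʳ-∣ p) (subproducts-∣ ps)))

-- Products that use p are multiples of p; the others divide the product of the remaining primes,
-- which p does not divide.
subproducts-unique : ∀ {ps} → All Prime ps → Unique ps → Unique (subproducts ps)
subproducts-unique []        []       = [] ∷ []
subproducts-unique {p ∷ ps} (pp ∷ pps) (u ∷ us) =
  Uniqueₚ.++⁺ (subproducts-unique pps us)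
              (Uniqueₚ.map⁺ (λ {x} {y} → *-cancelˡ-≡ x y p {{prime⇒nonZero pp}}) (subproducts-unique pps us))
              disjoint
  where
  disjoint : ∀ {x} → ¬ (x ∈ subproducts ps × x ∈ map (p *_) (subproducts ps))
  disjoint (x∈ , x∈p*) with ∈-map⁻ (p *_) x∈p*
  ... | y , _ , refl = contradiction refl (All.lookup u (factorisationHasAllPrimeFactors pp
                         (∣-trans (m∣m*n y) (All.lookup (subproducts-∣ ps) x∈)) pps))

2^length≤τ : ∀ {ps n} .{{_ : NonZero n}} → All Prime ps → Unique ps → All (_∣ n) ps → 2 ^ length ps ≤ τ n
2^length≤τ {ps} {n} pps us ps∣n = subst (_≤ τ n) (length-subproducts ps)
  (unique-⊆-length (subproducts-unique pps us)
    (λ x∈ → ∈-divisors (∣-trans (All.lookup (subproducts-∣ ps) x∈) (product-primes-∣ pps us ps∣n))))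

-- Each prime is returned with its d, because `primitive-injective` then shows that the next prime
-- is new.
primitives : ∀ {ds} → All (2 ≤_) ds → Unique ds →
  ∃ λ ps → length ps ≡ length ds × Unique ps × All (λ p → ∃ λ d → d ∈ ds × Primitive d p) ps
primitives []                    []       = [] , refl , [] , []
primitives {d ∷ ds} (2≤d ∷ 2≤ds) (u ∷ us) with ∃-primitive d 2≤d | primitives 2≤ds us
... | p , prim | ps , len , ups , prims =
  p ∷ ps , cong suc len , All.map fresh prims ∷ ups ,
  (d , here refl , prim) ∷ All.map (λ (e , e∈ , pr) → e , there e∈ , pr) prims
  where
  fresh : ∀ {q} → (∃ λ e → e ∈ ds × Primitive e q) → p ≢ q
  fresh (e , e∈ , pr) refl = All.lookup u e∈ (primitive-injective 2≤d (All.lookup 2≤ds e∈) prim pr)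

-- Written as the tail that remains when the candidate list of `divisors n` loses its head 1, so
-- that `τ≡1+length` holds by one `filter-accept`.
divisors≥2 : ℕ → List ℕ
divisors≥2 n = filter (_∣? n) (map suc (applyUpTo suc (pred n)))

divisors≥2-≥2 : ∀ n → All (2 ≤_) (divisors≥2 n)
divisors≥2-≥2 n = Allₚ.filter⁺ _ (Allₚ.map⁺ (Allₚ.applyUpTo⁺₂ suc (pred n) (λ _ → s≤s (s≤s z≤n))))

divisors≥2-unique : ∀ n → Unique (divisors≥2 n)
divisors≥2-unique n = Uniqueₚ.filter⁺ _ (Uniqueₚ.map⁺ suc-injective
  (Uniqueₚ.applyUpTo⁺₁ suc (pred n) (λ i<j _ eq → <⇒≢ i<j (suc-injective eq))))

∈-divisors≥2⇒∣ : ∀ {d} n → d ∈ divisors≥2 n → d ∣ n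
∈-divisors≥2⇒∣ n d∈ = proj₂ (∈-filter⁻ (_∣? n) {xs = map suc (applyUpTo suc (pred n))} d∈)

τ≡1+length : ∀ n .{{_ : NonZero n}} → τ n ≡ suc (length (divisors≥2 n))
τ≡1+length (suc n) = cong length (filter-accept (_∣? suc n) (1∣ suc n))

-- The factor 2 accounts for the divisor 1 of n, which contributes no primitive prime.
2^τ≤2*τ[B] : ∀ n .{{_ : NonZero n}} → 2 ^ τ n ≤ 2 * τ (B n)
2^τ≤2*τ[B] n with primitives (divisors≥2-≥2 n) (divisors≥2-unique n)
... | ps , len , unique , prims = begin
  2 ^ τ n                             ≡⟨ cong (2 ^_) (τ≡1+length n) ⟩
  2 * 2 ^ length (divisors≥2 n)       ≡⟨ cong (λ z → 2 * 2 ^ z) (sym len) ⟩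
  2 * 2 ^ length ps                   ≤⟨ *-monoʳ-≤ 2 (2^length≤τ {{B-nonZero n}} (All.map is-prime prims) unique (All.map divides-B prims)) ⟩
  2 * τ (B n)                         ∎
  where
  open ≤-Reasoning
  is-prime : ∀ {p} → (∃ λ d → d ∈ divisors≥2 n × Primitive d p) → Prime p
  is-prime (_ , _ , pp , _) = pp
  divides-B : ∀ {p} → (∃ λ d → d ∈ divisors≥2 n × Primitive d p) → p ∣ B n
  divides-B (_ , d∈ , _ , p∣Bd , _) = ∣-trans p∣Bd (B-mono-∣ (∈-divisors≥2⇒∣ n d∈))

-- The base 8 = 2³ matches the division of τ(n) by 3, and the factor 2 is the one lost to the
-- divisor 1.
2*B<8^ : ∀ k → 2 * B k < 8 ^ k
2*B<8^ zero          = s≤s z≤n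
2*B<8^ (suc zero)    = s≤s (s≤s (s≤s z≤n))
2*B<8^ (suc (suc k)) = begin-strict
  2 * B (2 + k)           ≤⟨ *-monoʳ-≤ 2 (m∸n≤m (6 * B (suc k)) (B k)) ⟩
  2 * (6 * B (suc k))     ≡⟨ swap (B (suc k)) ⟩
  6 * (2 * B (suc k))     <⟨ *-monoʳ-< 6 (2*B<8^ (suc k)) ⟩
  6 * 8 ^ suc k           ≤⟨ *-monoˡ-≤ (8 ^ suc k) (m≤m+n 6 2) ⟩
  8 * 8 ^ suc k           ∎
  where
  open ≤-Reasoning
  swap : ∀ x → 2 * (6 * x) ≡ 6 * (2 * x)
  swap = solve-∀

theorem3p2 : ∀ (n : ℕ) → n ≥ 1 → τ (B n) > B (τ n / 3)
theorem3p2 n n≥1 = *-cancelˡ-< 2 _ _ (begin-strict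
  2 * B (τ n / 3)      <⟨ 2*B<8^ (τ n / 3) ⟩
  8 ^ (τ n / 3)        ≡⟨ ^-*-assoc 2 3 (τ n / 3) ⟩
  2 ^ (3 * (τ n / 3))  ≤⟨ ^-monoʳ-≤ 2 (≤-trans (≤-reflexive (*-comm 3 (τ n / 3))) (m/n*n≤m (τ n) 3)) ⟩
  2 ^ τ n              ≤⟨ 2^τ≤2*τ[B] n {{>-nonZero n≥1}} ⟩
  2 * τ (B n)          ∎)
  where open ≤-Reasoning
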